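{- There is a function $\varepsilon(n)$ with $\varepsilon(n)\to 0$ as $n\to\infty$ such that for all integers $n,r\geq 2$ and every non-bipartite graph $G$ containing the path $P_n$ as a subgraph, $$\hat{R}(G,r)>(3.75-\varepsilon(n))\,2^{r-2}\,n.$$ In particular, this lower bound holds for $G=C_n$ when $n$ is odd.
   Context: For a graph $H$ and an integer $r\geq 2$, the $r$-color size-Ramsey number $\hat{R}(H,r)$ is the minimum number of edges of a graph $G$ such that every coloring of the edges of $G$ with $r$ colors contains a monochromatic copy of $H$. $P_n$ is the path on $n$ vertices and $C_n$ the cycle on $n$ vertices. -}

module Defs where

open import Data.Nat as ℕ using (ℕ; _<ᵇ_; _^_; _∸_)
open import Data.Fin using (Fin; toℕ; suc; zero; inject₁)
open import Data.Bool using (Bool; true; false; _∧_)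
open import Data.List using (List; length; filterᵇ; allFin; concatMap; map)
open import Data.Product using (Σ; _×_; _,_; proj₁; proj₂; ∃)
open import Data.Integer using (+_)
open import Data.Rational as ℚ using (ℚ; _/_; 0ℚ; ∣_∣)
open import Relation.Binary.PropositionalEquality using (_≡_; _≢_)
open import Relation.Nullary using (¬_)
open import Function.Definitions using (Injective)

record Graph : Set where
  field
    V     : ℕ
    adj   : Fin V → Fin V → Bool
    sym   : ∀ i j → adj i j ≡ adj j i
    irrefl : ∀ i → adj i i ≡ false
open Graph public

edgeList : (G : Graph) → List (Fin (V G) × Fin (V G))
edgeList G = filterᵇ (λ p → (toℕ (proj₁ p) <ᵇ toℕ (proj₂ p)) ∧ adj G (proj₁ p) (proj₂ p))
               (concatMap (λ i → map (i ,_) (allFin (V G))) (allFin (V G)))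

edges : Graph → ℕ
edges G = length (edgeList G)

Embedding : Graph → Graph → Set
Embedding H G = Σ (Fin (V H) → Fin (V G)) λ φ →
  Injective _≡_ _≡_ φ × (∀ i j → adj H i j ≡ true → adj G (φ i) (φ j) ≡ true)

-- an r-colouring of the edges of G (symmetric colour function on pairs;
-- only its values on edges matter)
Colouring : Graph → ℕ → Set
Colouring G r = Σ (Fin (V G) → Fin (V G) → Fin r) λ c → ∀ i j → c i j ≡ c j i

MonoCopy : (H G : Graph) (r : ℕ) → Colouring G r → Set
MonoCopy H G r c = Σ (Fin r) λ k → Σ (Embedding H G) λ e →
  ∀ i j → adj H i j ≡ true → proj₁ c (proj₁ e i) (proj₁ e j) ≡ k

RamseyFor : (G H : Graph) (r : ℕ) → Set
RamseyFor G H r = (c : Colouring G r) → MonoCopy H G r c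

SizeRamseyGreater : Graph → ℕ → ℚ → Set
SizeRamseyGreater H r x = ∀ (G : Graph) → RamseyFor G H r → x ℚ.< (+ edges G / 1)

ContainsPath : Graph → ℕ → Set
ContainsPath G n = Σ (Fin n → Fin (V G)) λ p →
  Injective _≡_ _≡_ p × (∀ i j → ℕ.suc (toℕ i) ≡ toℕ j → adj G (p i) (p j) ≡ true)

Bipartite : Graph → Set
Bipartite G = Σ (Fin (V G) → Bool) λ f → ∀ i j → adj G i j ≡ true → f i ≢ f j

TendsToZero : (ℕ → ℚ) → Set
TendsToZero ε = ∀ (δ : ℚ) → 0ℚ ℚ.< δ → ∃ λ N → ∀ n → N ℕ.≤ n → ∣ ε n ∣ ℚ.< δ

bound : ℚ → ℕ → ℕ → ℚ
bound e r n = ((+ 15 / 4) ℚ.- e) ℚ.* (+ (2 ^ (r ∸ 2)) / 1) ℚ.* (+ n / 1)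

{-# OPTIONS --safe #-}
-- Colouring the edges across a vertex bipartition with one colour never produces a monochromatic
-- non-bipartite G in that colour, so if F is Ramsey for G in r + 1 colours then the edges inside the two
-- parts are Ramsey for G in r colours.  With a maximum cut, this halves the number of edges for each
-- colour beyond the second.
--
-- For two colours, let D be the set of vertices of F of degree at least 4.  If |D| ≤ 2(n − 3), split D
-- evenly and extend the split to a bipartition that no vertex outside D improves by moving.  A vertex
-- outside D then has at most ⌊3/2⌋ = 1 neighbours in its own part, so the interior vertices of a path
-- inside one part lie in D, and the path has fewer than n vertices.  Hence |D| ≥ 2n − 5, and F has at
-- least 2|D| ≥ 4n − 10 edges, which exceeds 3.75 n as soon as n > 40.
module Submission where

open import Defs hiding (sym)
import Algebra.Properties.CommutativeMonoid.Sum
open import Data.Bool using (Bool; true; false; T; _∧_; _xor_; not; if_then_else_)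
open import Data.Bool.Properties using (T?; ∧-comm; xor-comm; xor-same; not-distribˡ-xor) renaming (_≟_ to _≟ᵇ_)
open import Data.Empty using (⊥-elim)
open import Data.Fin using (Fin; zero; suc; toℕ; inject₁; punchIn; punchOut)
open import Data.Fin.Properties using (all?; ¬∀⟶∃¬; punchInᵢ≢i; punchOut-injective; punchIn-punchOut; suc-injective; inject₁-injective; toℕ-inject₁; toℕ-injective) renaming (_≟_ to _≟ᶠ_)
import Data.Integer as ℤ
import Data.Integer.Properties as ℤ
open import Data.List using (List; _++_; length; filterᵇ; allFin; concatMap; map; tabulate)
open import Data.List.Properties using (length-++; filter-++; map-tabulate)
open import Data.Nat using (ℕ; zero; suc; _≤_; _<_; _+_; _*_; _^_; _∸_; _<ᵇ_; _≤ᵇ_; _≤?_; z≤n; s≤s; s≤s⁻¹)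
open import Data.Nat.Properties hiding (suc-injective)
open import Data.Nat.Tactic.RingSolver using (solve-∀)
open import Data.Product using (Σ; ∃; _×_; _,_; proj₁; proj₂)
open import Data.Rational as ℚ using (ℚ; 0ℚ; toℚᵘ)
import Data.Rational.Properties as ℚ
open import Data.Rational.Unnormalised as ℚᵘ using (mkℚᵘ; *<*)
import Data.Rational.Unnormalised.Properties as ℚᵘ
open import Data.Vec.Functional using (updateAt) renaming (_∷_ to _∷ᶠ_)
open import Data.Vec.Functional.Properties using (updateAt-updates; updateAt-minimal)
open import Function using (_∘_)
open import Function.Definitions using (Injective)
open import Relation.Binary.PropositionalEquality using (_≡_; _≢_; refl; sym; trans; cong; cong₂; subst; subst₂; module ≡-Reasoning)
open import Relation.Nullary using (¬_; Dec; yes; no; contradiction)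
open import Relation.Nullary.Decidable using (_→-dec_)

open Algebra.Properties.CommutativeMonoid.Sum +-0-commutativeMonoid using (sum; sum-cong-≗; sum-remove; ∑-comm; ∑-distrib-+)

-- Sums over Fin

ι : Bool → ℕ
ι b = if b then 1 else 0

count : ∀ {n} → (Fin n → Bool) → ℕ
count P = sum (ι ∘ P)

sum-mono-≤ : ∀ {n} {s t : Fin n → ℕ} → (∀ i → s i ≤ t i) → sum s ≤ sum t
sum-mono-≤ {zero}  s≤t = z≤n
sum-mono-≤ {suc n} s≤t = +-mono-≤ (s≤t zero) (sum-mono-≤ (s≤t ∘ suc))

*-distribˡ-sum : ∀ {n} k (t : Fin n → ℕ) → k * sum t ≡ sum (λ i → k * t i)
*-distribˡ-sum {zero}  k t = *-zeroʳ k
*-distribˡ-sum {suc n} k t =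
  trans (*-distribˡ-+ k (t zero) _) (cong (k * t zero +_) (*-distribˡ-sum k (t ∘ suc)))

-- Induction on `k`: the point `q zero` contributes one to the count, and deleting it from the
-- codomain leaves an injection of the remaining indices, because no other index is sent there.
injection⇒≤count : ∀ {k n} (P : Fin n → Bool) (q : Fin k → Fin n) → Injective _≡_ _≡_ q →
                   (∀ i → P (q i) ≡ true) → k ≤ count P
injection⇒≤count {zero}          P q q-inj Pq = z≤n
injection⇒≤count {suc k} {zero}  P q q-inj Pq with () ← q zero
injection⇒≤count {suc k} {suc n} P q q-inj Pq = begin
  suc k                                              ≤⟨ s≤s (injection⇒≤count (P ∘ punchIn (q zero)) q′ q′-inj Pq′) ⟩
  1 + count (P ∘ punchIn (q zero))                   ≡⟨ cong (λ b → ι b + count (P ∘ punchIn (q zero))) (Pq zero) ⟨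
  ι (P (q zero)) + count (P ∘ punchIn (q zero))      ≡⟨ sum-remove {i = q zero} (ι ∘ P) ⟨
  count P                                            ∎
  where
  open ≤-Reasoning
  q₀≢ : ∀ i → q zero ≢ q (suc i)
  q₀≢ i eq with () ← q-inj eq
  q′ : Fin k → Fin n
  q′ i = punchOut (q₀≢ i)
  q′-inj : Injective _≡_ _≡_ q′
  q′-inj {i} {j} eq = suc-injective (q-inj (punchOut-injective (q₀≢ i) (q₀≢ j) eq))
  Pq′ : ∀ i → P (punchIn (q zero) (q′ i)) ≡ true
  Pq′ i = trans (cong P (punchIn-punchOut (q₀≢ i))) (Pq (suc i))

-- Greedy choice: elements of `P` go to the first class until its capacity `a` is used up, then to
-- the second. Elements outside `P` use no capacity, so their value is arbitrary.
split : ∀ {n} (P : Fin n → Bool) a b → count P ≤ a + b →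
        ∃ λ (f : Fin n → Bool) → count (λ i → P i ∧ f i) ≤ a × count (λ i → P i ∧ not (f i)) ≤ b
split {zero}  P a b le = (λ ()) , z≤n , z≤n
split {suc n} P a b le with P zero
split {suc n} P a b le | false =
  let f , l , r = split (P ∘ suc) a b le in true ∷ᶠ f , l , r
split {suc n} P (suc a) b le | true =
  let f , l , r = split (P ∘ suc) a b (s≤s⁻¹ le) in true ∷ᶠ f , s≤s l , r
split {suc n} P zero (suc b) le | true =
  let f , l , r = split (P ∘ suc) zero b (s≤s⁻¹ le) in false ∷ᶠ f , l , s≤s r

-- Degrees

deg : (G : Graph) → Fin (V G) → ℕ
deg G v = count (adj G v)

∑deg : Graph → ℕ
∑deg G = sum (deg G)

length-filter-tabulate : ∀ {A : Set} {n} (P : A → Bool) (t : Fin n → A) →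
                         length (filterᵇ P (tabulate t)) ≡ count (P ∘ t)
length-filter-tabulate {n = zero}  P t = refl
length-filter-tabulate {n = suc n} P t with P (t zero)
... | true  = cong suc (length-filter-tabulate P (t ∘ suc))
... | false = length-filter-tabulate P (t ∘ suc)

length-filter-concatMap : ∀ {A B : Set} {n} (P : B → Bool) (g : A → List B) (t : Fin n → A) →
  length (filterᵇ P (concatMap g (tabulate t))) ≡ sum (λ i → length (filterᵇ P (g (t i))))
length-filter-concatMap {n = zero}  P g t = refl
length-filter-concatMap {n = suc n} P g t = begin
  length (filterᵇ P (g (t zero) ++ concatMap g (tabulate (t ∘ suc))))
    ≡⟨ cong length (filter-++ (T? ∘ P) (g (t zero)) _) ⟩
  length (filterᵇ P (g (t zero)) ++ filterᵇ P (concatMap g (tabulate (t ∘ suc))))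
    ≡⟨ length-++ (filterᵇ P (g (t zero))) ⟩
  length (filterᵇ P (g (t zero))) + length (filterᵇ P (concatMap g (tabulate (t ∘ suc))))
    ≡⟨ cong (length (filterᵇ P (g (t zero))) +_) (length-filter-concatMap P g (t ∘ suc)) ⟩
  sum (λ i → length (filterᵇ P (g (t i)))) ∎
  where open ≡-Reasoning

<ᵇ-split : ∀ m n → m ≢ n → ι (m <ᵇ n) + ι (n <ᵇ m) ≡ 1
<ᵇ-split zero    zero    m≢n = contradiction refl m≢n
<ᵇ-split zero    (suc n) m≢n = refl
<ᵇ-split (suc m) zero    m≢n = refl
<ᵇ-split (suc m) (suc n) m≢n = <ᵇ-split m n (m≢n ∘ cong suc)

module _ (G : Graph) where

  private
    up : Fin (V G) → Fin (V G) → Bool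
    up i j = (toℕ i <ᵇ toℕ j) ∧ adj G i j

  edges≡sum : edges G ≡ sum (λ i → count (up i))
  edges≡sum = trans (length-filter-concatMap up′ (λ i → map (i ,_) (allFin (V G))) (λ i → i)) (sum-cong-≗ λ i →
    trans (cong (length ∘ filterᵇ up′) (map-tabulate (λ j → j) (i ,_))) (length-filter-tabulate up′ (i ,_)))
    where
    up′ : Fin (V G) × Fin (V G) → Bool
    up′ (i , j) = up i j

  up-split : ∀ i j → ι (adj G i j) ≡ ι (up i j) + ι (up j i)
  up-split i j rewrite Graph.sym G j i with adj G i j in eq
  ... | false rewrite ∧-comm (toℕ i <ᵇ toℕ j) false | ∧-comm (toℕ j <ᵇ toℕ i) false = refl
  -- An edge is not a loop, so its endpoints differ and exactly one of the two orders is increasing.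
  ... | true  rewrite ∧-comm (toℕ i <ᵇ toℕ j) true | ∧-comm (toℕ j <ᵇ toℕ i) true =
    sym (<ᵇ-split (toℕ i) (toℕ j) λ i≡j → contradiction (trans (sym eq) (adj-≡ (toℕ-injective i≡j))) λ ())
    where
    adj-≡ : ∀ {i j} → i ≡ j → adj G i j ≡ false
    adj-≡ {i} refl = irrefl G i

  -- `edges` counts each edge only at its smaller endpoint. Splitting every adjacency by `up-split`
  -- and exchanging the order of summation gives this count twice.
  handshake : ∑deg G ≡ 2 * edges G
  handshake = begin
    sum (λ i → sum (λ j → ι (adj G i j)))
      ≡⟨ sum-cong-≗ (λ i → trans (sum-cong-≗ (up-split i)) (∑-distrib-+ (ι ∘ up i) _)) ⟩
    sum (λ i → count (up i) + sum (λ j → ι (up j i)))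
      ≡⟨ ∑-distrib-+ (λ i → count (up i)) _ ⟩
    sum (λ i → count (up i)) + sum (λ i → sum (λ j → ι (up j i)))
      ≡⟨ cong (sum (λ i → count (up i)) +_) (∑-comm (λ i j → ι (up j i))) ⟩
    sum (λ i → count (up i)) + sum (λ i → count (up i))
      ≡⟨ cong₂ _+_ edges≡sum edges≡sum ⟨
    edges G + edges G
      ≡⟨ cong (edges G +_) (+-identityʳ _) ⟨
    2 * edges G ∎
    where open ≡-Reasoning

-- Cuts

-- The vertex set is kept and only the edges across the cut are deleted, so that a cut can be
-- changed or a new one applied without relabelling vertices.
inside : (G : Graph) → (Fin (V G) → Bool) → Graph
inside G f = record
  { V      = V G
  ; adj    = λ i j → adj G i j ∧ not (f i xor f j)
  ; sym    = λ i j → cong₂ (λ a b → a ∧ not b) (Graph.sym G i j) (xor-comm (f i) (f j))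
  ; irrefl = λ i → cong (_∧ not (f i xor f i)) (irrefl G i)
  }

inside-adj : ∀ G f i j → adj (inside G f) i j ≡ true → adj G i j ≡ true × f i ≡ f j
inside-adj G f i j e with true ← adj G i j | f i | f j
... | true  | true  = refl , refl
... | false | false = refl , refl

-- A colouring of the inner edges extends to all of `G` by giving the cut edges a fresh colour
-- `zero`. A monochromatic copy in any other colour uses inner edges only.
RamseyFor-inside : ∀ {G H r} → ¬ Bipartite H → RamseyFor G H (suc r) → ∀ f → RamseyFor (inside G f) H r
RamseyFor-inside {G} {H} {r} H-odd ramsey f (c , c-sym) = restrict (ramsey (c⁺ , c⁺-sym))
  where
  colour : Bool → Fin r → Fin (suc r)
  colour cut k = if cut then zero else suc k
  c⁺ : Fin (V G) → Fin (V G) → Fin (suc r)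
  c⁺ i j = colour (f i xor f j) (c i j)
  c⁺-sym : ∀ i j → c⁺ i j ≡ c⁺ j i
  c⁺-sym i j = cong₂ colour (xor-comm (f i) (f j)) (c-sym i j)
  colour-zero : ∀ {x k} → colour x k ≡ zero → x ≡ true
  colour-zero {true} _ = refl
  colour-suc : ∀ {x k l} → colour x k ≡ suc l → x ≡ false × k ≡ l
  colour-suc {false} refl = refl , refl
  restrict : MonoCopy H G (suc r) (c⁺ , c⁺-sym) → MonoCopy H (inside G f) r (c , c-sym)
  -- All edges of such a copy cross the cut, so pulling `f` back along `φ` would 2-colour `H`.
  restrict (zero , (φ , _) , mono) = ⊥-elim (H-odd (f ∘ φ , λ i j e fi≡fj →
    contradiction (trans (sym (colour-zero (mono i j e))) (trans (cong (_xor f (φ j)) fi≡fj) (xor-same (f (φ j))))) λ ()))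
  restrict (suc k , (φ , φ-inj , hom) , mono) =
    k , (φ , φ-inj , λ i j e → cong₂ (λ a b → a ∧ not b) (hom i j e) (proj₁ (colour-suc (mono i j e))))
      , λ i j e → proj₂ (colour-suc (mono i j e))

-- By symmetry, row `v` and column `v` have the same sum, and the entry they share is zero.
sum²-remove : ∀ {n} (w : Fin (suc n) → Fin (suc n) → ℕ) v → (∀ i j → w i j ≡ w j i) → w v v ≡ 0 →
  sum (λ i → sum (w i)) ≡ 2 * sum (w v) + sum (λ i → sum (λ j → w (punchIn v i) (punchIn v j)))
sum²-remove w v w-sym wvv≡0 = begin
  sum (λ i → sum (w i))
    ≡⟨ sum-remove {i = v} (λ i → sum (w i)) ⟩
  sum (w v) + sum (λ i → sum (w (punchIn v i)))
    ≡⟨ cong (sum (w v) +_) (trans (sum-cong-≗ (λ i → sum-remove {i = v} (w (punchIn v i)))) (∑-distrib-+ (λ i → w (punchIn v i) v) _)) ⟩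
  sum (w v) + (sum (λ i → w (punchIn v i) v) + rest)
    ≡⟨ cong (λ s → sum (w v) + (s + rest)) column ⟩
  sum (w v) + (sum (w v) + rest)
    ≡⟨ regroup (sum (w v)) rest ⟩
  2 * sum (w v) + rest ∎
  where
  open ≡-Reasoning
  rest = sum (λ i → sum (λ j → w (punchIn v i) (punchIn v j)))
  column : sum (λ i → w (punchIn v i) v) ≡ sum (w v)
  column = begin
    sum (λ i → w (punchIn v i) v)          ≡⟨ sum-cong-≗ (λ i → w-sym (punchIn v i) v) ⟩
    sum (λ i → w v (punchIn v i))          ≡⟨ cong (_+ sum (λ i → w v (punchIn v i))) wvv≡0 ⟨
    w v v + sum (λ i → w v (punchIn v i))  ≡⟨ sum-remove {i = v} (w v) ⟨
    sum (w v)                              ∎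
  regroup : ∀ a b → a + (a + b) ≡ 2 * a + b
  regroup = solve-∀

sum²-mono-< : ∀ {n} (w w′ : Fin n → Fin n → ℕ) v →
  (∀ i j → w i j ≡ w j i) → (∀ i j → w′ i j ≡ w′ j i) → w v v ≡ 0 → w′ v v ≡ 0 →
  (∀ i j → i ≢ v → j ≢ v → w i j ≡ w′ i j) → sum (w v) < sum (w′ v) →
  sum (λ i → sum (w i)) < sum (λ i → sum (w′ i))
sum²-mono-< {suc n} w w′ v w-sym w′-sym wvv≡0 w′vv≡0 agree lt = begin-strict
  sum (λ i → sum (w i))
    ≡⟨ sum²-remove w v w-sym wvv≡0 ⟩
  2 * sum (w v) + sum (λ i → sum (λ j → w (punchIn v i) (punchIn v j)))
    ≡⟨ cong (2 * sum (w v) +_) (sum-cong-≗ λ i → sum-cong-≗ λ j → agree _ _ (punchInᵢ≢i v i) (punchInᵢ≢i v j)) ⟩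
  2 * sum (w v) + sum (λ i → sum (λ j → w′ (punchIn v i) (punchIn v j)))
    <⟨ +-monoˡ-< _ (*-monoʳ-< 2 lt) ⟩
  2 * sum (w′ v) + sum (λ i → sum (λ j → w′ (punchIn v i) (punchIn v j)))
    ≡⟨ sum²-remove w′ v w′-sym w′vv≡0 ⟨
  sum (λ i → sum (w′ i)) ∎
  where open ≤-Reasoning

flip : ∀ {n} → Fin n → (Fin n → Bool) → Fin n → Bool
flip v f = updateAt f v not

module _ (G : Graph) where

  -- Moving `v` exchanges its neighbours in its own part with those across the cut.
  deg-flip : ∀ f v → deg (inside G (flip v f)) v + deg (inside G f) v ≡ deg G v
  deg-flip f v = trans (sym (∑-distrib-+ (ι ∘ adj (inside G (flip v f)) v) _)) (sum-cong-≗ pointwise)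
    where
    cancel : ∀ a x → ι (a ∧ not (not x)) + ι (a ∧ not x) ≡ ι a
    cancel false x     = refl
    cancel true  true  = refl
    cancel true  false = refl
    pointwise : ∀ u → ι (adj (inside G (flip v f)) v u) + ι (adj (inside G f) v u) ≡ ι (adj G v u)
    pointwise u with u ≟ᶠ v
    ... | yes refl rewrite irrefl G v = refl
    ... | no  u≢v  rewrite updateAt-updates v {not} f | updateAt-minimal u v {not} f u≢v
                         | sym (not-distribˡ-xor (f v) (f u)) = cancel (adj G v u) (f v xor f u)

  -- A flip at `v` changes only row and column `v` of the adjacency matrix, so the total falls as
  -- soon as the inner degree of `v` does; by `deg-flip` it does when more than half of the
  -- neighbours lie in the part of `v`.
  ∑deg-flip : ∀ f v → deg G v < 2 * deg (inside G f) v → ∑deg (inside G (flip v f)) < ∑deg (inside G f)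
  ∑deg-flip f v lt = sum²-mono-< _ _ v
    (λ i j → cong ι (Graph.sym (inside G (flip v f)) i j)) (λ i j → cong ι (Graph.sym (inside G f) i j))
    (cong ι (irrefl (inside G (flip v f)) v)) (cong ι (irrefl (inside G f) v))
    (λ i j i≢v j≢v → cong₂ (λ x y → ι (adj G i j ∧ not (x xor y))) (updateAt-minimal i v f i≢v) (updateAt-minimal j v f j≢v))
    (+-cancelʳ-< (deg (inside G f) v) _ _ (begin-strict
      deg (inside G (flip v f)) v + deg (inside G f) v  ≡⟨ deg-flip f v ⟩
      deg G v                                           <⟨ lt ⟩
      2 * deg (inside G f) v                            ≡⟨ cong (deg (inside G f) v +_) (+-identityʳ _) ⟩
      deg (inside G f) v + deg (inside G f) v           ∎))
    where open ≤-Reasoning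

  -- `P` marks the vertices whose side is frozen; any other vertex must have at most half of its
  -- neighbours in its own part.
  Stable : (P f : Fin (V G) → Bool) → Fin (V G) → Set
  Stable P f v = P v ≡ false → 2 * deg (inside G f) v ≤ deg G v

  stable? : ∀ P f v → Dec (Stable P f v)
  stable? P f v = (P v ≟ᵇ false) →-dec (2 * deg (inside G f) v ≤? deg G v)

  -- Local search: flip an unstable vertex while there is one. Each flip lowers the inner degree
  -- sum, which `k` bounds, so the search ends.
  stableExtension : ∀ P f₀ → ∃ λ f → (∀ v → P v ≡ true → f v ≡ f₀ v) × (∀ v → Stable P f v)
  stableExtension P f₀ = improve (∑deg (inside G f₀)) f₀ ≤-refl (λ _ _ → refl)
    where
    improve : ∀ k f → ∑deg (inside G f) ≤ k → (∀ v → P v ≡ true → f v ≡ f₀ v) →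
              ∃ λ f → (∀ v → P v ≡ true → f v ≡ f₀ v) × (∀ v → Stable P f v)
    improve k f le agree with all? (stable? P f)
    ... | yes stable  = f , agree , stable
    ... | no  ¬stable with v , ¬stable-v ← ¬∀⟶∃¬ _ (Stable P f) (stable? P f) ¬stable = step k le
      where
      decrease : ∑deg (inside G (flip v f)) < ∑deg (inside G f)
      decrease = ∑deg-flip f v (≰⇒> λ stable-v → ¬stable-v λ _ → stable-v)
      -- Stability is vacuous on `P`, so an unstable vertex is not frozen and the flip preserves
      -- agreement with `f₀`.
      Pv≢true : P v ≢ true
      Pv≢true Pv = ¬stable-v λ Pv′ → contradiction (trans (sym Pv) Pv′) λ ()
      agree′ : ∀ u → P u ≡ true → flip v f u ≡ f₀ u
      agree′ u Pu = trans (updateAt-minimal u v f λ { refl → Pv≢true Pu }) (agree u Pu)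
      step : ∀ k → ∑deg (inside G f) ≤ k → ∃ λ f → (∀ v → P v ≡ true → f v ≡ f₀ v) × (∀ v → Stable P f v)
      step zero    le = contradiction (<-≤-trans decrease le) λ ()
      step (suc k) le = improve k (flip v f) (s≤s⁻¹ (<-≤-trans decrease le)) agree′

  halvingCut : ∃ λ f → 2 * edges (inside G f) ≤ edges G
  -- With no vertex frozen, stability holds everywhere and can be summed over all vertices.
  halvingCut with f , _ , stable ← stableExtension (λ _ → false) (λ _ → false) =
    f , *-cancelˡ-≤ 2 (begin
      2 * (2 * edges (inside G f))          ≡⟨ cong (2 *_) (handshake (inside G f)) ⟨
      2 * ∑deg (inside G f)                 ≡⟨ *-distribˡ-sum 2 (deg (inside G f)) ⟩
      sum (λ v → 2 * deg (inside G f) v)    ≤⟨ sum-mono-≤ (λ v → stable v refl) ⟩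
      ∑deg G                                ≡⟨ handshake G ⟩
      2 * edges G                           ∎)
    where open ≤-Reasoning

-- Paths inside the parts of a cut

heavy : (G : Graph) → Fin (V G) → Bool
heavy G v = 4 ≤ᵇ deg G v

¬heavy⇒deg≤3 : ∀ G v → heavy G v ≡ false → deg G v ≤ 3
¬heavy⇒deg≤3 G v light = ≮⇒≥ λ 4≤deg → subst T light (≤⇒≤ᵇ 4≤deg)

4*count-heavy≤∑deg : ∀ G → 4 * count (heavy G) ≤ ∑deg G
4*count-heavy≤∑deg G = ≤-trans (≤-reflexive (*-distribˡ-sum 4 (ι ∘ heavy G))) (sum-mono-≤ pointwise)
  where
  pointwise : ∀ v → 4 * ι (heavy G v) ≤ deg G v
  pointwise v with heavy G v in eq
  ... | true  = ≤ᵇ⇒≤ 4 (deg G v) (subst T (sym eq) _)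
  ... | false = z≤n

-- An interior vertex has two distinct path neighbours in its own part, too many for a stable vertex
-- of degree at most 3. The path stays on one side because none of its edges crosses the cut.
pathInterior-heavy : ∀ {m} G P f → (∀ v → P v ≡ false → deg G v ≤ 3) → (∀ v → Stable G P f v) →
  ContainsPath (inside G f) (3 + m) →
  Σ (Fin (1 + m) → Fin (V G)) λ q → Injective _≡_ _≡_ q × (∀ i → P (q i) ≡ true) × (∀ i j → f (q i) ≡ f (q j))
pathInterior-heavy {m} G P f light stable (p , p-inj , step) =
  q , q-inj , Pq , λ i j → trans (side (suc (inject₁ i))) (sym (side (suc (inject₁ j))))
  where
  q : Fin (1 + m) → Fin (V G)
  q i = p (suc (inject₁ i))
  q-inj : Injective _≡_ _≡_ q
  q-inj eq = inject₁-injective (suc-injective (p-inj eq))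

  forward : ∀ (i : Fin (2 + m)) → adj (inside G f) (p (inject₁ i)) (p (suc i)) ≡ true
  forward i = step _ _ (cong suc (toℕ-inject₁ i))
  backward : ∀ (i : Fin (2 + m)) → adj (inside G f) (p (suc i)) (p (inject₁ i)) ≡ true
  backward i = trans (Graph.sym (inside G f) _ _) (forward i)

  constant : ∀ {k} (g : Fin (suc k) → Bool) → (∀ i → g (inject₁ i) ≡ g (suc i)) → ∀ i → g i ≡ g zero
  constant g eq zero = refl
  constant {suc k} g eq (suc i) = trans (constant (g ∘ suc) (eq ∘ suc) i) (sym (eq zero))
  side : ∀ i → f (p i) ≡ f (p zero)
  side = constant (f ∘ p) λ i → proj₂ (inside-adj G f _ _ (forward i))

  neighbours : Fin (1 + m) → Fin 2 → Fin (V G)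
  neighbours i zero       = p (inject₁ (inject₁ i))
  neighbours i (suc zero) = p (suc (suc i))
  prev≢next : ∀ (i : Fin (1 + m)) → inject₁ (inject₁ i) ≢ suc (suc i)
  prev≢next i eq = m≢1+n+m (toℕ i) {1} (trans (sym (trans (toℕ-inject₁ (inject₁ i)) (toℕ-inject₁ i))) (cong toℕ eq))
  neighbours-inj : ∀ i → Injective _≡_ _≡_ (neighbours i)
  neighbours-inj i {zero}     {zero}     eq = refl
  neighbours-inj i {zero}     {suc zero} eq = ⊥-elim (prev≢next i (p-inj eq))
  neighbours-inj i {suc zero} {zero}     eq = ⊥-elim (prev≢next i (p-inj (sym eq)))
  neighbours-inj i {suc zero} {suc zero} eq = refl
  neighbours-adj : ∀ i k → adj (inside G f) (q i) (neighbours i k) ≡ true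
  neighbours-adj i zero       = backward (inject₁ i)
  neighbours-adj i (suc zero) = forward (suc i)
  2≤deg : ∀ i → 2 ≤ deg (inside G f) (q i)
  2≤deg i = injection⇒≤count _ (neighbours i) (neighbours-inj i) (neighbours-adj i)

  Pq : ∀ i → P (q i) ≡ true
  Pq i with P (q i) in eq
  ... | true  = refl
  -- Here 4 ≤ 2 · (inner degree) ≤ degree ≤ 3.
  ... | false = contradiction (≤-trans (*-monoʳ-≤ 2 (2≤deg i)) (≤-trans (stable (q i) eq) (light (q i) eq))) (<⇒≱ (n<1+n 3))

-- A path on `3 + m` vertices has `1 + m` interior ones, all heavy and on one side, while each side
-- receives at most `m` heavy vertices.
pathFreeCut : ∀ G m → count (heavy G) ≤ m + m → ∃ λ f → ¬ ContainsPath (inside G f) (3 + m)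
pathFreeCut G m few
  with f₀ , l , r ← split (heavy G) m m few
  with f , agree , stable ← stableExtension G (heavy G) f₀ = f , no-path
  where
  no-path : ¬ ContainsPath (inside G f) (3 + m)
  no-path path
    with q , q-inj , heavy-q , same ← pathInterior-heavy G (heavy G) f (¬heavy⇒deg≤3 G) stable path
    with f (q zero) in side
  ... | true  = contradiction (≤-trans (injection⇒≤count _ q q-inj λ i →
                  cong₂ _∧_ (heavy-q i) (trans (sym (agree (q i) (heavy-q i))) (trans (same i zero) side))) l) (<⇒≱ (n<1+n m))
  ... | false = contradiction (≤-trans (injection⇒≤count _ q q-inj λ i →
                  cong₂ (λ a b → a ∧ not b) (heavy-q i) (trans (sym (agree (q i) (heavy-q i))) (trans (same i zero) side))) r) (<⇒≱ (n<1+n m))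

-- Size-Ramsey lower bounds

ContainsPath-Embedding : ∀ {H G n} → Embedding H G → ContainsPath H n → ContainsPath G n
ContainsPath-Embedding (φ , φ-inj , hom) (p , p-inj , step) =
  φ ∘ p , p-inj ∘ φ-inj , λ i j eq → hom _ _ (step i j eq)

edges-Ramsey₂ : ∀ {G H m} → ¬ Bipartite H → ContainsPath H (3 + m) → RamseyFor G H 2 → 4 * m + 2 ≤ edges G
edges-Ramsey₂ {G} {H} {m} H-odd path ramsey with count (heavy G) ≤? m + m
... | yes few with f , no-path ← pathFreeCut G m few
              -- With one colour left, the constant colouring shows that the inner graph contains
              -- `H`, hence its path.
              with _ , e , _ ← RamseyFor-inside {G} {H} H-odd ramsey f ((λ _ _ → zero) , λ _ _ → refl) =
  contradiction (ContainsPath-Embedding {H} {inside G f} e path) no-path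
-- At least 2m + 1 heavy vertices give degree sum at least 4(2m + 1) = 2(4m + 2).
... | no many = *-cancelˡ-≤ 2 (begin
  2 * (4 * m + 2)      ≡⟨ regroup m ⟩
  4 * suc (m + m)      ≤⟨ *-monoʳ-≤ 4 (≰⇒> many) ⟩
  4 * count (heavy G)  ≤⟨ 4*count-heavy≤∑deg G ⟩
  ∑deg G               ≡⟨ handshake G ⟩
  2 * edges G          ∎)
  where
  open ≤-Reasoning
  regroup : ∀ m → 2 * (4 * m + 2) ≡ 4 * suc (m + m)
  regroup = solve-∀

-- Each colour beyond two is paid for by a halving cut: deleting its edges uses up one colour and
-- leaves at most half of the edges.
edges-Ramsey : ∀ {G H m} s → ¬ Bipartite H → ContainsPath H (3 + m) → RamseyFor G H (2 + s) →
               2 ^ s * (4 * m + 2) ≤ edges G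
edges-Ramsey {G} {H} {m} zero H-odd path ramsey =
  ≤-trans (≤-reflexive (+-identityʳ _)) (edges-Ramsey₂ {G} {H} H-odd path ramsey)
edges-Ramsey {G} {H} {m} (suc s) H-odd path ramsey with f , half ← halvingCut G = begin
  2 * 2 ^ s * (4 * m + 2)    ≡⟨ *-assoc 2 (2 ^ s) _ ⟩
  2 * (2 ^ s * (4 * m + 2))  ≤⟨ *-monoʳ-≤ 2 (edges-Ramsey {inside G f} {H} s H-odd path (RamseyFor-inside {G} {H} H-odd ramsey f)) ⟩
  2 * edges (inside G f)     ≤⟨ half ⟩
  edges G                    ∎
  where open ≤-Reasoning

-- Comparing rational bounds with edge counts

scaled-<-integer : ∀ z a n e → z ℤ.* ℤ.+ a ℤ.* ℤ.+ n ℤ.< ℤ.+ e ℤ.* ℤ.+ 4 →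
                   (z ℚ./ 4) ℚ.* (ℤ.+ a ℚ./ 1) ℚ.* (ℤ.+ n ℚ./ 1) ℚ.< ℤ.+ e ℚ./ 1
scaled-<-integer z a n e lt = ℚ.toℚᵘ-cancel-< (begin-strict
  toℚᵘ ((z ℚ./ 4) ℚ.* (ℤ.+ a ℚ./ 1) ℚ.* (ℤ.+ n ℚ./ 1))
    ≃⟨ ℚ.toℚᵘ-homo-* ((z ℚ./ 4) ℚ.* (ℤ.+ a ℚ./ 1)) (ℤ.+ n ℚ./ 1) ⟩
  toℚᵘ ((z ℚ./ 4) ℚ.* (ℤ.+ a ℚ./ 1)) ℚᵘ.* toℚᵘ (ℤ.+ n ℚ./ 1)
    ≃⟨ ℚᵘ.*-cong (ℚᵘ.≃-trans (ℚ.toℚᵘ-homo-* (z ℚ./ 4) (ℤ.+ a ℚ./ 1))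
         (ℚᵘ.*-cong (ℚ.toℚᵘ-fromℚᵘ (mkℚᵘ z 3)) (ℚ.toℚᵘ-fromℚᵘ (mkℚᵘ (ℤ.+ a) 0))))
         (ℚ.toℚᵘ-fromℚᵘ (mkℚᵘ (ℤ.+ n) 0)) ⟩
  mkℚᵘ z 3 ℚᵘ.* mkℚᵘ (ℤ.+ a) 0 ℚᵘ.* mkℚᵘ (ℤ.+ n) 0
    -- Unnormalised fractions keep the denominators 4 and 1, so the comparison is plain
    -- cross-multiplication.
    <⟨ *<* (subst (ℤ._< ℤ.+ e ℤ.* ℤ.+ 4) (sym (ℤ.*-identityʳ _)) lt) ⟩
  mkℚᵘ (ℤ.+ e) 0
    ≃⟨ ℚ.toℚᵘ-fromℚᵘ (mkℚᵘ (ℤ.+ e) 0) ⟨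
  toℚᵘ (ℤ.+ e ℚ./ 1) ∎)
  where open ℚᵘ.≤-Reasoning

negative-<-integer : ∀ a n e → 1 ≤ a → 1 ≤ n →
                     (ℤ.-1ℤ ℚ./ 4) ℚ.* (ℤ.+ a ℚ./ 1) ℚ.* (ℤ.+ n ℚ./ 1) ℚ.< ℤ.+ e ℚ./ 1
negative-<-integer (suc a) (suc n) e _ _ =
  scaled-<-integer ℤ.-1ℤ (suc a) (suc n) e (subst (_ ℤ.<_) (ℤ.pos-* e 4) ℤ.-<+)

15/4-<-integer : ∀ a m e → 1 ≤ a → 38 ≤ m → a * (4 * m + 2) ≤ e →
                 (ℤ.+ 15 ℚ./ 4) ℚ.* (ℤ.+ a ℚ./ 1) ℚ.* (ℤ.+ (3 + m) ℚ./ 1) ℚ.< ℤ.+ e ℚ./ 1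
15/4-<-integer a m e 1≤a 38≤m le = scaled-<-integer (ℤ.+ 15) a (3 + m) e
  (subst₂ ℤ._<_ (trans (ℤ.pos-* (15 * a) (3 + m)) (cong (ℤ._* ℤ.+ (3 + m)) (ℤ.pos-* 15 a))) (ℤ.pos-* e 4) (ℤ.+<+ (begin-strict
    -- Since 15 · 3 = 7 + 38, the bound `38 ≤ m` gives at most 16m + 7, one less than 4(4m + 2);
    -- positivity of `a` makes this strict.
    15 * a * (3 + m)               ≡⟨ regroup₁ a m ⟩
    a * (15 * m + 7 + 38)          ≤⟨ *-monoʳ-≤ a (+-monoʳ-≤ (15 * m + 7) 38≤m) ⟩
    a * (15 * m + 7 + m)           <⟨ m<m+n _ 1≤a ⟩
    a * (15 * m + 7 + m) + a       ≡⟨ regroup₂ a m ⟩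
    a * (4 * m + 2) * 4            ≤⟨ *-monoˡ-≤ 4 le ⟩
    e * 4                          ∎)))
  where
  open ≤-Reasoning
  regroup₁ : ∀ a m → 15 * a * (3 + m) ≡ a * (15 * m + 7 + 38)
  regroup₁ = solve-∀
  regroup₂ : ∀ a m → a * (15 * m + 7 + m) + a ≡ a * (4 * m + 2) * 4
  regroup₂ = solve-∀

-- The value 4 makes the claimed bound negative.
error : ℕ → ℚ
error n with n ≤? 40
... | yes _ = ℤ.+ 4 ℚ./ 1
... | no  _ = 0ℚ

error-small : ∀ {n} → n ≤ 40 → error n ≡ ℤ.+ 4 ℚ./ 1
error-small {n} n≤40 with n ≤? 40
... | yes _    = refl
... | no  n≰40 = contradiction n≤40 n≰40

error-large : ∀ {n} → 41 ≤ n → error n ≡ 0ℚ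
error-large {n} 41≤n with n ≤? 40
... | yes n≤40 = contradiction n≤40 (<⇒≱ 41≤n)
... | no  _    = refl

error→0 : TendsToZero error
error→0 δ 0<δ = 41 , λ n 41≤n → subst (λ e → ℚ.∣ e ∣ ℚ.< δ) (sym (error-large 41≤n)) 0<δ

theorem4p3 : Σ (ℕ → ℚ) λ ε → TendsToZero ε ×
    (∀ (n r : ℕ) → 2 ≤ n → 2 ≤ r → (G : Graph) → ¬ Bipartite G → ContainsPath G n →
    SizeRamseyGreater G r (bound (ε n) r n))
theorem4p3 = error , error→0 , lower
  where
  lower : ∀ (n r : ℕ) → 2 ≤ n → 2 ≤ r → (G : Graph) → ¬ Bipartite G → ContainsPath G n →
          SizeRamseyGreater G r (bound (error n) r n)
  lower n (suc zero)    2≤n (s≤s ()) _ _ _ _ _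
  lower n (suc (suc s)) 2≤n _ G G-odd path F ramsey = by-size (n ≤? 40)
    where
    Bounded : ℚ → ℕ → Set
    Bounded c n = c ℚ.* (ℤ.+ (2 ^ s) ℚ./ 1) ℚ.* (ℤ.+ n ℚ./ 1) ℚ.< ℤ.+ edges F ℚ./ 1
    large : ∀ m → 3 + m ≡ n → 41 ≤ n → Bounded (ℤ.+ 15 ℚ./ 4) n
    large m refl 41≤n = 15/4-<-integer (2 ^ s) m (edges F) (m^n>0 2 s) (+-cancelˡ-≤ 3 _ _ 41≤n)
                          (edges-Ramsey {F} {G} s G-odd path ramsey)
    by-size : Dec (n ≤ 40) → Bounded ((ℤ.+ 15 ℚ./ 4) ℚ.- error n) n
    -- Here 15/4 - 4 evaluates to -1/4, so the bound is negative whatever `F` is.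
    by-size (yes n≤40) = subst (λ e → Bounded ((ℤ.+ 15 ℚ./ 4) ℚ.- e) n) (sym (error-small n≤40))
      (negative-<-integer (2 ^ s) n (edges F) (m^n>0 2 s) (<⇒≤ 2≤n))
    by-size (no n≰40) = subst (λ e → Bounded ((ℤ.+ 15 ℚ./ 4) ℚ.- e) n) (sym (error-large 41≤n))
      (large (n ∸ 3) (m+[n∸m]≡n (≤-trans (m≤m+n 3 38) 41≤n)) 41≤n)
      where
      41≤n : 41 ≤ n
      41≤n = ≰⇒> n≰40
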